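{- For every integer $n\geq 16$ there exists a graph $G$ on $n+1$ vertices with $r(G) > \frac{1}{3} n\log n$, together with a vertex $v\in V(G)$ such that the graph $H = G\setminus\{v\}$ obtained by deleting $v$ satisfies $r(H) = n$.
   Context: For a graph $F$, the Ramsey number $r(F)$ is the minimum $N$ such that every two-coloring of the edges of the complete graph $K_N$ contains a monochromatic copy of $F$. All logarithms are to base $2$. -}

module Defs where

open import Data.Bool.Base using (Bool)
open import Data.Fin.Base using (Fin; punchIn)
open import Data.Integer.Base using (+_; -[1+_])
open import Data.Nat.Base using (ℕ; suc; _≤_; _<_; _*_; _^_)
open import Data.Product.Base using (_×_; ∃-syntax)
open import Data.Rational.Unnormalised.Base as ℚᵘ using (ℚᵘ; mkℚᵘ)
open import Function.Definitions using (Injective)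
open import Level using (0ℓ)
open import Relation.Binary.Core using (Rel)
open import Relation.Binary.Definitions using (Symmetric; Irreflexive; Decidable)
open import Relation.Binary.PropositionalEquality.Core using (_≡_)

record Graph (n : ℕ) : Set₁ where
  field
    _~_      : Rel (Fin n) 0ℓ
    ~-sym    : Symmetric _~_
    ~-irrefl : Irreflexive _≡_ _~_
    _~?_     : Decidable _~_

infixl 6 _∖_

_∖_ : ∀ {n} → Graph (suc n) → Fin (suc n) → Graph n
G ∖ v = record
  { _~_      = λ i j → punchIn v i ~ punchIn v j
  ; ~-sym    = ~-sym
  ; ~-irrefl = λ { _≡_.refl → ~-irrefl _≡_.refl }
  ; _~?_     = λ i j → punchIn v i ~? punchIn v j
  }
  where open Graph G

-- An edge {i , j} of K_N is coloured by `colour i j`. The diagonal values are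
-- never inspected, since copies are injective and graphs have no loops.
record EdgeColouring (N : ℕ) : Set where
  field
    colour     : Fin N → Fin N → Bool
    colour-sym : ∀ i j → colour i j ≡ colour j i

-- Copies need not be induced. Injectivity covers isolated vertices too, so a
-- copy of F always uses as many vertices as F has.
record MonochromaticCopy {n N : ℕ} (F : Graph n) (χ : EdgeColouring N) : Set where
  open Graph F
  open EdgeColouring χ
  field
    embed     : Fin n → Fin N
    injective : Injective _≡_ _≡_ embed
    hue       : Bool
    mono      : ∀ {i j} → i ~ j → colour (embed i) (embed j) ≡ hue

infix 4 _⟶_

_⟶_ : ∀ {n} → ℕ → Graph n → Set
N ⟶ F = (χ : EdgeColouring N) → MonochromaticCopy F χ

-- r(F) = N, as a relation: N is the least number with N ⟶ F.
IsRamseyNumber : ∀ {n} → Graph n → ℕ → Set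
IsRamseyNumber F N = (N ⟶ F) × (∀ M → M ⟶ F → N ≤ M)

infix 4 log₂_<_ _·log₂_<_

-- The real number log₂ m is given by its upper Dedekind cut:
-- log₂ m < p / d  iff  m ^ d < 2 ^ p  (for p negative, iff m ^ d * 2 ^ (- p) < 1).
log₂_<_ : ℕ → ℚᵘ → Set
log₂ m < mkℚᵘ (+ p)    d-1 = m ^ suc d-1 < 2 ^ p
log₂ m < mkℚᵘ -[1+ p ] d-1 = m ^ suc d-1 * 2 ^ suc p < 1

-- The real inequality c · log₂ m < x, for m ≥ 1 and c ≥ 0 only: multiplication
-- by a negative c would need the lower cut of log₂ m.
_·log₂_<_ : ℚᵘ → ℕ → ℚᵘ → Set
c ·log₂ m < x = ∃[ q ] (log₂ m < q) × (c ℚᵘ.* q ℚᵘ.< x)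

{-# OPTIONS --safe #-}
module Submission where

-- Let k = ⌊log₂ n / 2⌋, and let G consist of a clique K_{k+1} with n - k pendant
-- edges at one of its vertices v. Deleting v leaves K_k with isolated vertices,
-- whose Ramsey number is n because r(K_k) ≤ 4 ^ k ≤ n. On the other hand k
-- disjoint cliques of size n in one colour, with all edges between them in the
-- other, contain no monochromatic G, so r(G) > k n. Now k n ≥ n (2k + 2) / 3 since
-- k ≥ 2, and 2k + 2 > log₂ n.
-- That r(G) exists constructively takes, besides Ramsey's theorem, a decision
-- procedure for N ⟶ G, by exhaustive search over colourings and embeddings.

open import Data.Bool.Base using (Bool; true; false)
open import Data.Bool.Properties as Bool using ()
open import Data.Fin.Base using (Fin; zero; suc; toℕ; inject≤; combine; remQuot)
open import Data.Fin.Properties as Fin using (any?; all?; injective⇒≤)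
open import Data.Integer.Base as ℤ using (+_)
open import Data.Integer.Properties as ℤ using ()
open import Data.List.Base using (List; []; _∷_; _++_; length; take; lookup; filter; allFin)
open import Data.List.Properties using (length-tabulate)
open import Data.List.Relation.Binary.Permutation.Propositional using (_↭_; refl; prep; ↭-trans; ↭-sym; ↭⇒↭ₛ)
open import Data.List.Relation.Binary.Permutation.Propositional.Properties using (shift; ↭-length)
open import Data.List.Relation.Binary.Permutation.Setoid.Properties using (Unique-resp-↭)
open import Data.List.Relation.Binary.Sublist.Propositional using (_⊆_; []; _∷_; _∷ʳ_; ⊆-trans; minimum)
open import Data.List.Relation.Binary.Sublist.Propositional.Properties using (filter-⊆; All-resp-⊆)
open import Data.List.Relation.Unary.All using (All; []; _∷_)
open import Data.List.Relation.Unary.All.Properties using (all-filter)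
open import Data.List.Relation.Unary.AllPairs using (AllPairs; []; _∷_)
open import Data.List.Relation.Unary.AllPairs.Properties using (take⁺)
open import Data.List.Relation.Unary.Unique.Propositional using (Unique)
open import Data.List.Relation.Unary.Unique.Propositional.Properties using (allFin⁺)
open import Data.Nat.Base as ℕ using (ℕ; zero; suc; _+_; _^_; _≤_; _<_; z≤n; s≤s)
open import Data.Nat.Properties as ℕ using (≤-trans; ≤-refl; ≰⇒>; m^n>0; _≤?_; _<?_)
open import Data.Nat.Tactic.RingSolver using (solve-∀)
open import Data.Product.Base using (_×_; _,_; proj₁; proj₂; Σ-syntax; ∃; ∃-syntax)
open import Data.Rational.Unnormalised.Base using (_/_; _*_; mkℚᵘ; *<*)
open import Data.Sum.Base using (_⊎_; inj₁; inj₂)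
open import Data.Vec.Functional as Vector using (Vector)
open import Function.Base using (_∘_; id)
open import Function.Bundles using (mk⇔)
open import Function.Definitions using (Injective)
open import Level using (0ℓ)
open import Relation.Binary.Core using (Rel)
open import Relation.Binary.Definitions using (Symmetric; Reflexive; _Respects_)
open import Relation.Binary.PropositionalEquality
  using (_≡_; _≢_; refl; sym; trans; cong; cong₂; subst; subst₂; setoid; module ≡-Reasoning)
open import Relation.Nullary.Decidable
  using (Dec; yes; no; does; map′; ¬?; decidable-stable; dec-true; dec-false; does-⇔; _×-dec_; _⊎-dec_; _→-dec_)
open import Relation.Nullary.Negation using (¬_; contradiction)
open import Relation.Unary using (Pred; Decidable)
open import Defs

private variable
  A : Set
  k m n N : ℕ

-- Lists: sublists, prefixes and positions.

-- Lets a clique be listed first among all vertices of K_N, with `zs` left over for isolated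
-- vertices.
⊆⇒↭-++ : {xs ys : List A} → ys ⊆ xs → ∃[ zs ] xs ↭ ys ++ zs
⊆⇒↭-++ []         = [] , refl
⊆⇒↭-++ {ys = ys} (x ∷ʳ p) with zs , q ← ⊆⇒↭-++ p =
  x ∷ zs , ↭-trans (prep x q) (↭-sym (shift x ys zs))
⊆⇒↭-++ (refl ∷ p) with zs , q ← ⊆⇒↭-++ p = zs , prep _ q

take-length-++ : (xs ys : List A) → take (length xs) (xs ++ ys) ≡ xs
take-length-++ []       ys = refl
take-length-++ (x ∷ xs) ys = cong (x ∷_) (take-length-++ xs ys)

All-take-lookup : ∀ {P : Pred A 0ℓ} k xs → All P (take k xs) →
  ∀ i → toℕ i < k → P (lookup xs i)
All-take-lookup (suc k) (x ∷ xs) (px ∷ pxs) zero    i<k       = px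
All-take-lookup (suc k) (x ∷ xs) (px ∷ pxs) (suc i) (s≤s i<k) = All-take-lookup k xs pxs i i<k

-- `AllPairs` records each pair in list order only; symmetry of `R` supplies the other order.
AllPairs-take-lookup : ∀ {R : Rel A 0ℓ} → Symmetric R → ∀ k xs → AllPairs R (take k xs) →
  ∀ i j → i ≢ j → toℕ i < k → toℕ j < k → R (lookup xs i) (lookup xs j)
AllPairs-take-lookup R-sym (suc k) (x ∷ xs) (px ∷ pxs) zero zero i≢j _ _ = contradiction refl i≢j
AllPairs-take-lookup R-sym (suc k) (x ∷ xs) (px ∷ pxs) zero (suc j) i≢j _ (s≤s j<k) =
  All-take-lookup k xs px j j<k
AllPairs-take-lookup R-sym (suc k) (x ∷ xs) (px ∷ pxs) (suc i) zero i≢j (s≤s i<k) _ =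
  R-sym (All-take-lookup k xs px i i<k)
AllPairs-take-lookup R-sym (suc k) (x ∷ xs) (px ∷ pxs) (suc i) (suc j) i≢j (s≤s i<k) (s≤s j<k) =
  AllPairs-take-lookup R-sym k xs pxs i j (i≢j ∘ cong suc) i<k j<k

lookup-injective : {xs : List A} → Unique xs → Injective _≡_ _≡_ (lookup xs)
lookup-injective {xs = xs} xs! {i} {j} eq = decidable-stable (i Fin.≟ j) λ i≢j →
  AllPairs-take-lookup (λ x≢y → x≢y ∘ sym) (length xs) xs (take⁺ (length xs) xs!)
    i j i≢j (Fin.toℕ<n i) (Fin.toℕ<n j) eq

-- Ramsey's theorem for cliques.

module _ (c : A → A → Bool) where

  neighbours : Bool → A → List A → List A
  neighbours h x = filter (λ y → c x y Bool.≟ h)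

  length-neighbours : ∀ x ys →
    length (neighbours true x ys) + length (neighbours false x ys) ≡ length ys
  length-neighbours x [] = refl
  length-neighbours x (y ∷ ys) with c x y
  ... | true  = cong suc (length-neighbours x ys)
  ... | false = trans (ℕ.+-suc _ _) (cong suc (length-neighbours x ys))

  Clique : Bool → ℕ → List A → Set
  Clique h k xs = ∃[ ys ] ys ⊆ xs × AllPairs (λ x y → c x y ≡ h) ys × length ys ≡ k

  emptyClique : ∀ h xs → Clique h 0 xs
  emptyClique h xs = [] , minimum xs , [] , refl

  extendClique : ∀ {h} x xs → Clique h k (neighbours h x xs) → Clique h (suc k) (x ∷ xs)
  extendClique {h = h} x xs (ys , ys⊆ , mono , eq) =
    x ∷ ys ,
    refl ∷ ⊆-trans ys⊆ (filter-⊆ _ xs) ,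
    All-resp-⊆ ys⊆ (all-filter (λ y → c x y Bool.≟ h) xs) ∷ mono ,
    cong suc eq

  weakenClique : ∀ {g h} x xs → Clique h k (neighbours g x xs) → Clique h k (x ∷ xs)
  weakenClique x xs (ys , ys⊆ , mono , eq) =
    ys , x ∷ʳ ⊆-trans ys⊆ (filter-⊆ _ xs) , mono , eq

  -- Call `true` red and `false` blue. The first vertex has either 2 ^ (a + b - 1) red neighbours or
  -- as many blue ones. A clique found among them is extended by that vertex if it has the matching
  -- colour, and kept as it is otherwise.
  ramsey : ∀ a b xs → 2 ^ (a + b) ≤ length xs → Clique true a xs ⊎ Clique false b xs
  ramsey zero    b       xs       _     = inj₁ (emptyClique true xs)
  ramsey (suc a) zero    xs       _     = inj₂ (emptyClique false xs)
  ramsey (suc a) (suc b) []       large = contradiction large (ℕ.<⇒≱ (m^n>0 2 (suc a + suc b)))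
  ramsey (suc a) (suc b) (x ∷ xs) large
    with 2 ^ (a + suc b) ≤? length (neighbours true x xs)
  ... | yes reds-large with ramsey a (suc b) (neighbours true x xs) reds-large
  ...   | inj₁ clique = inj₁ (extendClique x xs clique)
  ...   | inj₂ clique = inj₂ (weakenClique x xs clique)
  ramsey (suc a) (suc b) (x ∷ xs) large | no reds-small
    with ramsey (suc a) b (neighbours false x xs) blues-large
    where
    reds  = length (neighbours true x xs)
    blues = length (neighbours false x xs)
    X     = 2 ^ (a + suc b)
    open ℕ.≤-Reasoning
    blues-large : 2 ^ (suc a + b) ≤ blues
    -- Too few red neighbours means `suc reds ≤ X`, and this unit pays for `x` itself.
    blues-large = subst (λ e → 2 ^ e ≤ blues) (ℕ.+-suc a b) (ℕ.+-cancelˡ-≤ X X blues (begin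
      X + X              ≡⟨ cong (λ z → X + z) (ℕ.+-identityʳ X) ⟨
      X + (X + 0)        ≤⟨ large ⟩
      suc (length xs)    ≡⟨ cong suc (length-neighbours x xs) ⟨
      suc reds + blues   ≤⟨ ℕ.+-monoˡ-≤ blues (≰⇒> reds-small) ⟩
      X + blues          ∎))
  ... | inj₁ clique = inj₁ (weakenClique x xs clique)
  ... | inj₂ clique = inj₂ (extendClique x xs clique)

monochromaticClique : ∀ (c : A → A → Bool) k xs → 2 ^ (k + k) ≤ length xs → ∃[ h ] Clique c h k xs
monochromaticClique c k xs large with ramsey c k k xs large
... | inj₁ clique = true  , clique
... | inj₂ clique = false , clique

-- Bounds for graphs with isolated vertices.

-- All edges of `F` lie among its first k vertices. These go to a monochromatic k-clique, and the
-- isolated rest to any other vertices of K_N.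
⟶-fromSupport : (F : Graph n) → (∀ {i j} → Graph._~_ F i j → toℕ i < k) →
  n ≤ N → 2 ^ (k + k) ≤ N → N ⟶ F
⟶-fromSupport {n} {k} {N} F support n≤N large χ
  with h , ys , ys⊆ , mono , refl ←
         monochromaticClique (EdgeColouring.colour χ) k (allFin N)
           (subst (2 ^ (k + k) ≤_) (sym (length-tabulate id)) large)
  -- `ys ++ zs` lists each vertex of K_N once, clique first; vertex `i` of `F` is sent to entry `i`.
  with zs , perm ← ⊆⇒↭-++ ys⊆ = record
  { embed     = embed
  ; injective = Fin.inject≤-injective n≤l n≤l _ _ ∘ lookup-injective unique
  ; hue       = h
  ; mono      = λ {i} {j} i~j →
      AllPairs-take-lookup (λ {x} {y} → trans (colour-sym y x)) k (ys ++ zs)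
        (subst (AllPairs _) (sym (take-length-++ ys zs)) mono)
        (position i) (position j)
        (λ eq → ~-irrefl (Fin.inject≤-injective n≤l n≤l i j eq) i~j)
        (position<k i~j) (position<k (~-sym i~j))
  }
  where
  open Graph F
  open EdgeColouring χ
  n≤l : n ≤ length (ys ++ zs)
  n≤l = subst (n ≤_) (trans (sym (length-tabulate id)) (↭-length perm)) n≤N
  position : Fin n → Fin (length (ys ++ zs))
  position i = inject≤ i n≤l
  position<k : ∀ {i j} → i ~ j → toℕ (position i) < k
  position<k i~j = subst (_< k) (sym (Fin.toℕ-inject≤ _ n≤l)) (support i~j)
  embed : Fin n → Fin N
  embed = lookup (ys ++ zs) ∘ position
  unique : Unique (ys ++ zs)
  unique = Unique-resp-↭ (setoid (Fin N)) (↭⇒↭ₛ perm) (allFin⁺ N)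

⟶⇒≤ : (F : Graph n) → N ⟶ F → n ≤ N
⟶⇒≤ F N⟶F = injective⇒≤ (MonochromaticCopy.injective (N⟶F constant))
  where constant = record { colour = λ _ _ → true ; colour-sym = λ _ _ → refl }

-- Deciding the arrow relation by exhaustive search.

-- Function extensionality is unavailable, so the predicates searched have to
-- respect an equivalence, which is pointwise equality for function types.
Searchable : (A : Set) → Rel A 0ℓ → Set₁
Searchable A _≈_ = ∀ {P : Pred A 0ℓ} → P Respects _≈_ → Decidable P → Dec (∃ P)

searchBool : Searchable Bool _≡_
searchBool {P} _ P? = map′
  (λ { (inj₁ p) → true , p ; (inj₂ p) → false , p })
  (λ { (true , p) → inj₁ p ; (false , p) → inj₂ p })
  (P? true ⊎-dec P? false)

searchFin : Searchable (Fin n) _≡_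
searchFin _ = any?

searchVector : ∀ {_≈_ : Rel A 0ℓ} → Reflexive _≈_ → Searchable A _≈_ →
  ∀ n → Searchable (Vector A n) (λ f g → ∀ i → f i ≈ g i)
searchVector ≈-refl search zero resp P? = map′
  (λ p → Vector.[] , p) (λ (f , p) → resp (λ ()) p) (P? Vector.[])
searchVector ≈-refl search (suc n) resp P? = map′
  (λ (a , f , p) → a Vector.∷ f , p)
  -- `f` agrees only pointwise with its head put before its tail, so `resp` carries `p` across.
  (λ (f , p) → f zero , f ∘ suc , resp (λ { zero → ≈-refl ; (suc i) → ≈-refl }) p)
  (search
    (λ a≈b (f , p) → f , resp (λ { zero → a≈b ; (suc i) → ≈-refl }) p)
    (λ a → searchVector ≈-refl search n
      (λ f≈g → resp (λ { zero → ≈-refl ; (suc i) → f≈g i }))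
      (P? ∘ (a Vector.∷_))))

module _ {n : ℕ} (F : Graph n) {N : ℕ} where
  open Graph F

  IsCopy : (Fin N → Fin N → Bool) → Bool → (Fin n → Fin N) → Set
  IsCopy c h f = (∀ i j → f i ≡ f j → i ≡ j) × (∀ i j → i ~ j → c (f i) (f j) ≡ h)

  isCopy-resp : ∀ {c d f g h} → (∀ i j → c i j ≡ d i j) → (∀ i → f i ≡ g i) →
    IsCopy c h f → IsCopy d h g
  isCopy-resp {c} c≗d f≗g (inj , mono) =
    (λ i j gi≡gj → inj i j (trans (f≗g i) (trans gi≡gj (sym (f≗g j))))) ,
    (λ i j i~j → trans (sym (c≗d _ _))
      (trans (cong₂ c (sym (f≗g i)) (sym (f≗g j))) (mono i j i~j)))

  isCopy? : ∀ c h f → Dec (IsCopy c h f)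
  isCopy? c h f =
    all? (λ i → all? λ j → (f i Fin.≟ f j) →-dec (i Fin.≟ j)) ×-dec
    all? (λ i → all? λ j → (i ~? j) →-dec (c (f i) (f j) Bool.≟ h))

  HasCopy : (Fin N → Fin N → Bool) → Set
  HasCopy c = ∃[ h ] ∃[ f ] IsCopy c h f

  hasCopy? : ∀ c → Dec (HasCopy c)
  hasCopy? c = searchBool (λ { refl → id }) λ h →
    searchVector refl searchFin n (isCopy-resp {c} {c} (λ _ _ → refl)) (isCopy? c h)

  -- The search runs over all functions, so symmetry becomes one of the conditions tested.
  Avoids : (Fin N → Fin N → Bool) → Set
  Avoids c = (∀ i j → c i j ≡ c j i) × ¬ HasCopy c

  avoids-resp : ∀ {c d} → (∀ i j → c i j ≡ d i j) → Avoids c → Avoids d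
  avoids-resp c≗d (c-sym , none) =
    (λ i j → trans (sym (c≗d i j)) (trans (c-sym i j) (c≗d j i))) ,
    (λ (h , f , copy) → none (h , f , isCopy-resp (λ i j → sym (c≗d i j)) (λ _ → refl) copy))

  avoidable? : Dec (∃ Avoids)
  avoidable? = searchVector (λ _ → refl) (searchVector refl searchBool N) N avoids-resp λ c →
    all? (λ i → all? λ j → c i j Bool.≟ c j i) ×-dec ¬? (hasCopy? c)

_⟶?_ : ∀ N (F : Graph n) → Dec (N ⟶ F)
N ⟶? F = map′ toArrow fromArrow (¬? (avoidable? F))
  where
  open EdgeColouring
  open MonochromaticCopy
  toArrow : ¬ ∃ (Avoids F) → N ⟶ F
  toArrow unavoidable χ
    -- That no colouring avoids `F` gives only a doubly negated copy; decidability of `HasCopy`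
    -- turns it into an actual one.
    with h , f , inj , mono ← decidable-stable (hasCopy? F (colour χ))
           (λ none → unavoidable (colour χ , colour-sym χ , none)) = record
    { embed = f ; injective = inj _ _ ; hue = h ; mono = mono _ _ }
  fromArrow : N ⟶ F → ¬ ∃ (Avoids F)
  fromArrow N⟶F (c , c-sym , none) = none (hue copy , embed copy ,
      (λ _ _ → injective copy) , (λ _ _ → mono copy))
    where copy = N⟶F (record { colour = c ; colour-sym = c-sym })

-- Existence of Ramsey numbers.

least : ∀ {P : Pred ℕ 0ℓ} → Decidable P → P m → ∃[ r ] P r × (∀ M → P M → r ≤ M)
least {zero}  P? p = zero , p , λ _ _ → z≤n
least {suc m} P? p with P? zero
... | yes p₀ = zero , p₀ , λ _ _ → z≤n
... | no ¬p₀ with r , pr , r-min ← least {m} (P? ∘ suc) p =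
  suc r , pr , λ { zero p₀ → contradiction p₀ ¬p₀ ; (suc M) pM → s≤s (r-min M pM) }

n<2^n : ∀ n → n < 2 ^ n
n<2^n zero    = s≤s z≤n
n<2^n (suc n) = ℕ.+-mono-≤ (m^n>0 2 n) (≤-trans (n<2^n n) (ℕ.m≤m+n _ 0))

n≤2^[n+n] : ∀ n → n ≤ 2 ^ (n + n)
n≤2^[n+n] n = ≤-trans (ℕ.m≤m+n n n) (ℕ.<⇒≤ (n<2^n (n + n)))

ramseyNumber : (F : Graph n) → ∃[ r ] IsRamseyNumber F r
ramseyNumber {n} F =
  least (_⟶? F) (⟶-fromSupport F (λ {i} _ → Fin.toℕ<n i) (n≤2^[n+n] n) ≤-refl)

-- The graph G and its vertex-deleted subgraph.

-- Vertex `zero` is the centre v and belongs to the clique, which for k ≤ n consists of the k + 1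
-- vertices numbered 0 to k.
pendantClique : ∀ k n → Graph (suc n)
pendantClique k n = record
  { _~_      = λ i j → i ≢ j × (i ≡ zero ⊎ j ≡ zero ⊎ (toℕ i ≤ k × toℕ j ≤ k))
  ; ~-sym    = λ
    { (i≢j , inj₁ i≡0)               → i≢j ∘ sym , inj₂ (inj₁ i≡0)
    ; (i≢j , inj₂ (inj₁ j≡0))        → i≢j ∘ sym , inj₁ j≡0
    ; (i≢j , inj₂ (inj₂ (i≤k , j≤k))) → i≢j ∘ sym , inj₂ (inj₂ (j≤k , i≤k))
    }
  ; ~-irrefl = λ i≡j (i≢j , _) → i≢j i≡j
  ; _~?_     = λ i j → ¬? (i Fin.≟ j) ×-dec
      ((i Fin.≟ zero) ⊎-dec ((j Fin.≟ zero) ⊎-dec ((toℕ i ≤? k) ×-dec (toℕ j ≤? k))))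
  }

isRamseyNumber-pendantClique∖0 : 2 ^ (k + k) ≤ n → IsRamseyNumber (pendantClique k n ∖ zero) n
isRamseyNumber-pendantClique∖0 {k} {n} large =
  -- No surviving vertex is `zero`, and `suc i ≤ k` says that `i` is among the first k.
  ⟶-fromSupport H (λ { (_ , inj₂ (inj₂ (i<k , _))) → i<k }) ≤-refl large ,
  λ M → ⟶⇒≤ H
  where H = pendantClique k n ∖ zero

-- The lower bound for r(G).

module _ (k n : ℕ) {N : ℕ} (N≤kn : N ≤ k ℕ.* n) where

  -- Places K_N in a k by n grid whose rows are the blocks of the colouring.
  coordinates : Fin N → Fin k × Fin n
  coordinates x = remQuot {k} n (inject≤ x N≤kn)

  coordinates-injective : Injective _≡_ _≡_ coordinates
  coordinates-injective {x} {y} eq = Fin.inject≤-injective N≤kn N≤kn x y (begin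
    inject≤ x N≤kn                                          ≡⟨ Fin.combine-remQuot {k} n _ ⟨
    combine (proj₁ (coordinates x)) (proj₂ (coordinates x)) ≡⟨ cong (λ (q , r) → combine q r) eq ⟩
    combine (proj₁ (coordinates y)) (proj₂ (coordinates y)) ≡⟨ Fin.combine-remQuot {k} n _ ⟩
    inject≤ y N≤kn                                          ∎)
    where open ≡-Reasoning

  block : Fin N → Fin k
  block = proj₁ ∘ coordinates

  blockColouring : EdgeColouring N
  blockColouring = record
    { colour     = λ x y → does (block x Fin.≟ block y)
    ; colour-sym = λ x y → does-⇔ (mk⇔ sym sym) (block x Fin.≟ block y) (block y Fin.≟ block x)
    }

  -- With hue `true`, every vertex shares the block of the centre, so n + 1 vertices would fit into
  -- n places. With hue `false`, the k + 1 clique vertices would lie in distinct blocks, of which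
  -- there are k.
  ¬MonochromaticCopy-blockColouring : k ≤ n → ¬ MonochromaticCopy (pendantClique k n) blockColouring
  ¬MonochromaticCopy-blockColouring _ record { embed = f ; injective = f-inj ; hue = true ; mono = mono } =
    contradiction (injective⇒≤ offset-injective) ℕ.1+n≰n
    where
    sameBlock : ∀ i → block (f i) ≡ block (f zero)
    sameBlock zero    = refl
    sameBlock (suc i) = decidable-stable (_ Fin.≟ _) λ distinct →
      contradiction
        (trans (sym (mono ((λ ()) , inj₂ (inj₁ refl)))) (dec-false (_ Fin.≟ _) distinct))
        λ ()
    offset-injective : Injective _≡_ _≡_ (proj₂ ∘ coordinates ∘ f)
    offset-injective {i} {j} eq = f-inj (coordinates-injective
      (cong₂ _,_ (trans (sameBlock i) (sym (sameBlock j))) eq))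
  ¬MonochromaticCopy-blockColouring k≤n record { embed = f ; hue = false ; mono = mono } =
    contradiction (injective⇒≤ block-injective) ℕ.1+n≰n
    where
    vertex : Fin (suc k) → Fin (suc n)
    vertex i = inject≤ i (s≤s k≤n)
    vertex≤k : ∀ i → toℕ (vertex i) ≤ k
    vertex≤k i = subst (_≤ k) (sym (Fin.toℕ-inject≤ i (s≤s k≤n))) (Fin.toℕ≤pred[n] i)
    block-injective : Injective _≡_ _≡_ (block ∘ f ∘ vertex)
    block-injective {i} {j} eq = decidable-stable (i Fin.≟ j) λ i≢j →
      contradiction
        (trans (sym (dec-true (_ Fin.≟ _) eq))
          (mono ( i≢j ∘ Fin.inject≤-injective (s≤s k≤n) (s≤s k≤n) i j
                , inj₂ (inj₂ (vertex≤k i , vertex≤k j)))))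
        λ ()

pendantClique-arrows⇒> : k ≤ n → N ⟶ pendantClique k n → k ℕ.* n < N
pendantClique-arrows⇒> {k} {n} k≤n N⟶G = ≰⇒> λ N≤kn →
  ¬MonochromaticCopy-blockColouring k n N≤kn k≤n (N⟶G (blockColouring k n N≤kn))

-- Choice of k and the numerical estimate.

halfLog : ∀ n → 1 ≤ n → ∃[ k ] 2 ^ (k + k) ≤ n × n < 2 ^ (suc k + suc k)
halfLog (suc zero)    _ = 0 , s≤s z≤n , s≤s (s≤s z≤n)
halfLog (suc n@(suc _)) _ with k , lower , upper ← halfLog n (s≤s z≤n)
  with suc n <? 2 ^ (suc k + suc k)
... | yes upper′ = k , ℕ.m≤n⇒m≤1+n lower , upper′
-- Here `suc n` has reached 4 ^ (k + 1), so k goes up by one; it cannot have passed 4 ^ (k + 1), by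
-- the old upper bound.
... | no  lower′ = suc k , ℕ.≮⇒≥ lower′ ,
  ℕ.≤-<-trans upper (ℕ.^-monoʳ-< 2 (s≤s (s≤s z≤n)) (ℕ.+-mono-< (ℕ.n<1+n (suc k)) (ℕ.n<1+n (suc k))))

theorem1p2 : ∀ (n : ℕ) → 16 ≤ n →
    Σ[ G ∈ Graph (suc n) ]
    (∃[ r ] IsRamseyNumber G r × ((+ 1 / 3) * (+ n / 1)) ·log₂ n < (+ r / 1))
    × (Σ[ v ∈ Fin (suc n) ] IsRamseyNumber (G ∖ v) n)
theorem1p2 n 16≤n
  with k , 4^k≤n , n<4^[1+k] ← halfLog n (≤-trans (s≤s z≤n) 16≤n)
  with r , r-ramsey ← ramseyNumber (pendantClique k n) =
  pendantClique k n ,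
  -- The rational above log₂ n is the integer 2k + 2; the `0` encodes denominator 1.
  (r , r-ramsey , mkℚᵘ (+ (suc k + suc k)) 0 , log-bound , *<* ratio-bound) ,
  zero , isRamseyNumber-pendantClique∖0 4^k≤n
  where
  open ℕ.≤-Reasoning

  kn<r : k ℕ.* n < r
  kn<r = pendantClique-arrows⇒>
    (≤-trans (ℕ.m≤m+n k k) (≤-trans (ℕ.<⇒≤ (n<2^n (k + k))) 4^k≤n)) (proj₁ r-ramsey)

  log-bound : n ^ 1 < 2 ^ (suc k + suc k)
  log-bound = subst (_< 2 ^ (suc k + suc k)) (sym (ℕ.^-identityʳ n)) n<4^[1+k]

  -- The hypothesis 16 ≤ n enters here: k ≤ 1 would force n < 2 ^ 4.
  2≤k : 2 ≤ k
  2≤k = ℕ.≮⇒≥ λ k<2 → ℕ.<⇒≱ n<4^[1+k]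
    (≤-trans (ℕ.^-monoʳ-≤ 2 (ℕ.+-mono-≤ k<2 k<2)) 16≤n)

  n[2k+2]<3r : n ℕ.* (suc k + suc k) < r ℕ.* 3
  n[2k+2]<3r = begin-strict
    n ℕ.* (suc k + suc k) ≡⟨ cong (n ℕ.*_) (expand k) ⟩
    n ℕ.* (2 + (k + k))   ≤⟨ ℕ.*-monoʳ-≤ n (ℕ.+-monoˡ-≤ (k + k) 2≤k) ⟩
    n ℕ.* (k + (k + k))   ≡⟨ regroup n k ⟩
    k ℕ.* n ℕ.* 3         <⟨ ℕ.*-monoˡ-< 3 kn<r ⟩
    r ℕ.* 3               ∎
    where
    expand : ∀ k → suc k + suc k ≡ 2 + (k + k)
    expand = solve-∀
    regroup : ∀ n k → n ℕ.* (k + (k + k)) ≡ k ℕ.* n ℕ.* 3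
    regroup = solve-∀

  -- The inequality (1/3) n (2k + 2) < r after cross-multiplication; the last `+ 1` is the
  -- denominator of r.
  ratio-bound : + 1 ℤ.* + n ℤ.* + (suc k + suc k) ℤ.* + 1 ℤ.< + r ℤ.* + 3
  ratio-bound = subst₂ ℤ._<_ cast-lhs (ℤ.pos-* r 3) (ℤ.+<+ n[2k+2]<3r)
    where
    cast-lhs : + (n ℕ.* (suc k + suc k)) ≡ + 1 ℤ.* + n ℤ.* + (suc k + suc k) ℤ.* + 1
    cast-lhs = trans (ℤ.pos-* n (suc k + suc k))
      (trans (cong (ℤ._* + (suc k + suc k)) (sym (ℤ.*-identityˡ (+ n)))) (sym (ℤ.*-identityʳ _)))
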